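{- For every DBI normal formula $\varphi$, the pointed action model $(\mathcal{U}_\varphi,0)$ (more precisely, its pointed frame $(\langle E^\varphi,Q^\varphi\rangle,0)$) is privatized with respect to $\varphi$.
   Context: Agents $\mathcal{A}=\{1,\dots,n\}$, $n>1$; language $\mathcal{L}$: $\varphi ::= p \mid \neg\varphi \mid (\varphi\wedge\varphi)\mid B_i\varphi$, $\top$ the usual tautology. An action model $\mathcal{U}=\langle E,Q,\mathsf{pre}\rangle$ has a nonempty set $E$ of events, relations $Q_i\subseteq E\times E$, $\mathsf{pre}:E\to\mathcal{L}$. Target agents: $\mathsf{ta}(p)=\varnothing$, $\mathsf{ta}(\neg\phi)=\mathsf{ta}(\phi)$, $\mathsf{ta}(\phi\wedge\psi)=\mathsf{ta}(\phi)\cup\mathsf{ta}(\psi)$, $\mathsf{ta}(B_i\phi)=\{i\}$. DBI formulas: $\varphi ::= B_i\xi \mid B_i(\xi\wedge\varphi)\mid(\varphi\wedge\varphi)\mid B_i\varphi$, $\xi$ purely propositional. DBI normal: $B_i\xi$ always; $B_i\varphi$, $B_i(\xi\wedge\varphi)$ iff $\varphi$ DBI normal and $i\notin\mathsf{ta}(\varphi)$; $\varphi\wedge\psi$ iff both DBI normal and $\mathsf{ta}(\varphi)\cap\mathsf{ta}(\psi)=\varnothing$. Action model $\mathcal{U}_\varphi=\langle E^\varphi,Q^\varphi,\mathsf{pre}^\varphi\rangle$ for DBI normal $\varphi$, recursively; always $E^\varphi=\{0,-1\}\sqcup D^\varphi$, $\varnothing\ne D^\varphi\subseteq\{1,2,\dots\}$,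 $\mathsf{pre}^\varphi(0)=\mathsf{pre}^\varphi(-1)=\top$; $\underline{Q}_j:=Q_j\cap((E\setminus\{0\})\times(E\setminus\{0\}))$. (1) $\varphi=B_i\xi$: $D=\{m\}$, $\mathsf{pre}(m)=\xi$, $Q_j=\{(0,-1),(m,-1),(-1,-1)\}$ ($j\ne i$), $Q_i=\{(0,m),(m,m),(-1,-1)\}$. (2) $\varphi=B_i\psi$: fresh $m\ge1$, $m\notin D^\psi$; $D^\varphi=D^\psi\sqcup\{m\}$; $\mathsf{pre}^\varphi$ extends $\mathsf{pre}^\psi$ with $\mathsf{pre}^\varphi(m)=\top$; $Q^\varphi_j=\underline{Q}^\psi_j\cup\{(0,-1)\}\cup\{(m,k)\mid(0,k)\in Q^\psi_j\}$ ($j\ne i$); $Q^\varphi_i=\underline{Q}^\psi_i\cup\{(0,m),(m,m)\}$. (3) $\varphi=B_i(\xi\wedge\psi)$: as (2) but $\mathsf{pre}^\varphi(m)=\xi$. (4) $\varphi=\psi\wedge\theta$: with $D^\psi\cap D^\theta=\varnothing$, $D^\varphi=D^\psi\sqcup D^\theta$, $\mathsf{pre}^\varphi=\mathsf{pre}^\psi\cup\mathsf{pre}^\theta$, $Q^\varphi_j=\underline{Q}^\psi_j\cup\underline{Q}^\theta_j\cup\{(0,k)\mid(0,k)\in Q^\psi_j\cup Q^\theta_j, k\in D^\psi\sqcup D^\theta\}\cup\{(0,-1)\mid\text{no such }k\text{ exists}\}$. Modal syntactic tree $\mathcal{T}_\varphi$ of a DBI formula (an out-tree with unlabeled root, other nodes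 labeled by agents/modalities): $\mathcal{T}_{B_i\xi}$ is a root with one child labeled $B_i$; $\mathcal{T}_{B_i\psi}=\mathcal{T}_{B_i(\xi\wedge\psi)}$ is obtained by labeling the root of $\mathcal{T}_\psi$ with $B_i$ and making it the only child of a new root; $\mathcal{T}_{\psi\wedge\theta}$ is the disjoint union of $\mathcal{T}_\psi$ and $\mathcal{T}_\theta$ with their roots identified. $RootP(\varphi)$ is the set of paths in $\mathcal{T}_\varphi$ starting at the root (of any length $l\ge0$); the agent sequence $\mathsf{agSeq}(\sigma)=(i_1,\dots,i_l)$ of such a path lists the agents labeling its non-root nodes in order (empty for the empty path). For a frame $\mathcal{F}=\langle W,R\rangle$, $w\in W$ and an agent sequence $(i_1,\dots,i_l)$, the cluster is $C^{i_1,\dots,i_l}_{\mathcal{F},w}=\{u\in W\mid \exists u_2,\dots,u_l\in W:\ wR_{i_1}u_2R_{i_2}\cdots u_lR_{i_l}u\}$, with $C^\varepsilon_{\mathcal{F},w}=\{w\}$. $\mathcal{A}^l_{\mathrm{nsr}}$ is the set of agent sequences of length $l$ with no two successive equal agents. $(\mathcal{F},w)$ is privatized w.r.t. $\varphi$ iff for every $\sigma\in RootP(\varphi)$: $C^{\mathsf{agSeq}(\sigma)}_{\mathcal{F},w}\neq\varnothing$ and for every $s\in\bigcup_{l\ge0}\mathcal{A}^l_{\mathrm{nsr}}\setminus\{\mathsf{agSeq}(\sigma)\}$, $C^{\mathsf{agSeq}(\sigma)}_{\mathcal{F},w}\cap C^{s}_{\mathcal{F},w}=\varnothing$. -}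

module Defs where

open import Data.Fin using (Fin)
open import Data.Fin.Subset using (Subset; ⊥; ⁅_⁆; _∪_; _∩_; Empty; _∉_)
open import Data.Integer using (ℤ; +_; 0ℤ; -1ℤ; _<_; _≤_; suc)
open import Data.Integer.Properties using (_≟_; ≤-refl; ≤-trans; ≤-<-trans; <-≤-trans;
  <-irrefl; <⇒≤; n≤1+n; suc[i]≤j⇒i<j)
open import Data.Irrelevant using ([_])
open import Data.List using (List; []; _∷_; _++_)
import Data.List.Membership.DecPropositional as DecMembership
open import Data.List.Membership.Propositional using (_∈_) renaming (_∉_ to _∉ˡ_)
open import Data.List.Relation.Binary.Disjoint.Propositional using (Disjoint)
open import Data.List.Relation.Unary.All as All using (All; []; _∷_)
open import Data.List.Relation.Unary.All.Properties using (++⁺)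
open import Data.List.Relation.Unary.Any using (here)
open import Data.List.Relation.Unary.Linked using (Linked)
open import Data.Nat using (ℕ)
open import Data.Product using (Σ-syntax; ∃-syntax; _×_; _,_; proj₁; proj₂)
open import Data.Refinement using (Refinement; _,_; value)
open import Data.Sum using (_⊎_)
open import Level using (0ℓ)
open import Relation.Binary using (Rel)
open import Relation.Binary.PropositionalEquality using (_≡_; _≢_; refl)
open import Relation.Nullary using (¬_; yes; no)
open import Relation.Unary as Pred using (Pred; Satisfiable)

private
  variable
    n  : ℕ
    At : Set

infixr 6 _∧_

data Form (n : ℕ) (At : Set) : Set where
  var : At → Form n At
  neg : Form n At → Form n At
  _∧_ : Form n At → Form n At → Form n At
  B   : Fin n → Form n At → Form n At

private
  variable
    i     : Fin n
    ξ φ ψ : Form n At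

-- The language has no primitive constant, so ⊤ is the instance ¬(p ∧ ¬p)
-- for some chosen atom p.
taut : At → Form n At
taut p = neg (var p ∧ neg (var p))

ta : Form n At → Subset n
ta (var p) = ⊥
ta (neg φ) = ta φ
ta (φ ∧ ψ) = ta φ ∪ ta ψ
ta (B i φ) = ⁅ i ⁆

data Propositional {n At} : Form n At → Set where
  var : (p : At) → Propositional (var p)
  neg : Propositional φ → Propositional (neg φ)
  _∧_ : Propositional φ → Propositional ψ → Propositional (φ ∧ ψ)

data DBI {n At} : Form n At → Set where
  B-prop : ∀ i → Propositional ξ → DBI (B i ξ)
  B-∧    : ∀ i → Propositional ξ → DBI φ → DBI (B i (ξ ∧ φ))
  conj   : DBI φ → DBI ψ → DBI (φ ∧ ψ)
  B      : ∀ i → DBI φ → DBI (B i φ)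

data Normal {n At} : {φ : Form n At} → DBI φ → Set where
  B-prop : {π : Propositional ξ} → Normal (B-prop i π)
  B-∧    : {π : Propositional ξ} {d : DBI φ} →
           Normal d → i ∉ ta φ → Normal (B-∧ i π d)
  conj   : {d : DBI φ} {e : DBI ψ} →
           Normal d → Normal e → Empty (ta φ ∩ ta ψ) → Normal (conj d e)
  B      : {d : DBI φ} → Normal d → i ∉ ta φ → Normal (B i d)

record Frame (n : ℕ) : Set₁ where
  field
    World : Set
    R     : Fin n → Rel World 0ℓ

record ActionModel (n : ℕ) (At : Set) : Set₁ where
  field
    Event    : Set
    nonempty : Event
    Q        : Fin n → Rel Event 0ℓ
    pre      : Event → Form n At

  frame : Frame n
  frame = record { World = Event ; R = Q }

-- The action model of a formula is determined only up to the choice of the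
-- fresh events m introduced along the recursion. A construction records one
-- admissible choice; D is the resulting set of positive events.
mutual
  data Construction {n At} : {φ : Form n At} → DBI φ → Set where
    B-prop : {π : Propositional ξ} (m : ℤ) → 0ℤ < m → Construction (B-prop i π)
    B-∧    : {π : Propositional ξ} {d : DBI φ} (c : Construction d) (m : ℤ) →
             0ℤ < m → m ∉ˡ D c → Construction (B-∧ i π d)
    conj   : {d : DBI φ} {e : DBI ψ} (c : Construction d) (c′ : Construction e) →
             Disjoint (D c) (D c′) → Construction (conj d e)
    B      : {d : DBI φ} (c : Construction d) (m : ℤ) →
             0ℤ < m → m ∉ˡ D c → Construction (B i d)

  D : {d : DBI φ} → Construction d → List ℤ
  D (B-prop m _)  = m ∷ []
  D (B-∧ c m _ _) = m ∷ D c
  D (conj c c′ _) = D c ++ D c′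
  D (B c m _ _)   = m ∷ D c

E : {d : DBI φ} → Construction d → List ℤ
E c = 0ℤ ∷ -1ℤ ∷ D c

underline : Rel ℤ 0ℓ → Rel ℤ 0ℓ
underline R x y = R x y × x ≢ 0ℤ × y ≢ 0ℤ

-- The relations Qᵠ_j for φ = B_i ψ and φ = B_i (ξ ∧ ψ), given Qᵠ for ψ.
prefixQ : Fin n → ℤ → (Fin n → Rel ℤ 0ℓ) → Fin n → Rel ℤ 0ℓ
prefixQ i m Q j x y =
    underline (Q j) x y
  ⊎ (j ≢ i × ((x ≡ 0ℤ × y ≡ -1ℤ) ⊎ (x ≡ m × Q j 0ℤ y)))
  ⊎ (j ≡ i × (x , y) ∈ (0ℤ , m) ∷ (m , m) ∷ [])

Qᶻ : {φ : Form n At} {d : DBI φ} → Construction d → Fin n → Rel ℤ 0ℓ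
Qᶻ (B-prop {i = i} m _) j x y =
    (j ≢ i × (x , y) ∈ (0ℤ , -1ℤ) ∷ (m , -1ℤ) ∷ (-1ℤ , -1ℤ) ∷ [])
  ⊎ (j ≡ i × (x , y) ∈ (0ℤ , m) ∷ (m , m) ∷ (-1ℤ , -1ℤ) ∷ [])
Qᶻ (B-∧ {i = i} c m _ _) = prefixQ i m (Qᶻ c)
Qᶻ (B {i = i} c m _ _)   = prefixQ i m (Qᶻ c)
Qᶻ (conj c c′ _) j x y   =
    underline (Qᶻ c j) x y
  ⊎ underline (Qᶻ c′ j) x y
  ⊎ (x ≡ 0ℤ × Initial y)
  ⊎ (x ≡ 0ℤ × y ≡ -1ℤ × ¬ (∃[ k ] Initial k))
  where
  Initial : Pred ℤ 0ℓ
  Initial k = (Qᶻ c j 0ℤ k ⊎ Qᶻ c′ j 0ℤ k) × k ∈ D c ++ D c′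

-- Total on ℤ: 0, -1 and all integers that are not events get ⊤.
preᶻ : {φ : Form n At} {d : DBI φ} → At → Construction d → ℤ → Form n At
preᶻ p (B-prop {ξ = ξ} m _) x with x ≟ m
... | yes _ = ξ
... | no  _ = taut p
preᶻ p (B-∧ {ξ = ξ} c m _ _) x with x ≟ m
... | yes _ = ξ
... | no  _ = preᶻ p c x
preᶻ p (conj c c′ _) x with DecMembership._∈?_ _≟_ x (D c)
... | yes _ = preᶻ p c x
... | no  _ = preᶻ p c′ x
preᶻ p (B c m _ _) x with x ≟ m
... | yes _ = taut p
... | no  _ = preᶻ p c x

EventOf : {d : DBI φ} → Construction d → Set
EventOf c = Refinement ℤ (λ x → x ∈ E c)

0ᴱ : {d : DBI φ} (c : Construction d) → EventOf c
0ᴱ c = 0ℤ , [ here refl ]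

𝒰 : {φ : Form n At} {d : DBI φ} → At → Construction d → ActionModel n At
𝒰 p c = record
  { Event    = EventOf c
  ; nonempty = 0ᴱ c
  ; Q        = λ j x y → Qᶻ c j (value x) (value y)
  ; pre      = λ x → preᶻ p c (value x)
  }

-- Every DBI formula has a construction, with events above any given bound.
constructionAbove : (d : DBI φ) (a : ℤ) → 0ℤ ≤ a →
  Σ[ c ∈ Construction d ] ∃[ b ] a ≤ b × All (λ x → a < x × x ≤ b) (D c)
constructionAbove {n} {At} = go
  where
  i<suc : ∀ x → x < suc x
  i<suc x = suc[i]≤j⇒i<j ≤-refl

  fresh : ∀ {a b} {xs : List ℤ} → All (λ x → a < x × x ≤ b) xs → suc b ∉ˡ xs
  fresh {b = b} bs s∈ =
    <-irrefl refl (<-≤-trans (i<suc b) (proj₂ (All.lookup bs s∈)))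

  step : ∀ {a b} {xs : List ℤ} → a ≤ b → All (λ x → a < x × x ≤ b) xs →
         a ≤ suc b × All (λ x → a < x × x ≤ suc b) (suc b ∷ xs)
  step {b = b} a≤b bs =
      <⇒≤ a<s
    , (a<s , ≤-refl)
    ∷ All.map (λ (l , u) → l , ≤-trans u (<⇒≤ (i<suc b))) bs
    where a<s = ≤-<-trans a≤b (i<suc b)

  go : {φ : Form n At} (d : DBI φ) (a : ℤ) → 0ℤ ≤ a →
       Σ[ c ∈ Construction d ] ∃[ b ] a ≤ b × All (λ x → a < x × x ≤ b) (D c)
  go (B-prop i π) a 0≤a =
    B-prop (suc a) (≤-<-trans 0≤a (i<suc a)) , suc a , step ≤-refl []
  go (B-∧ i π d) a 0≤a with go d a 0≤a
  ... | c , b , a≤b , bs =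
    B-∧ c (suc b) (≤-<-trans (≤-trans 0≤a a≤b) (i<suc b)) (fresh bs) , suc b , step a≤b bs
  go (B i d) a 0≤a with go d a 0≤a
  ... | c , b , a≤b , bs =
    B c (suc b) (≤-<-trans (≤-trans 0≤a a≤b) (i<suc b)) (fresh bs) , suc b , step a≤b bs
  go (conj d e) a 0≤a with go d a 0≤a
  ... | c , b , a≤b , bs with go e b (≤-trans 0≤a a≤b)
  ... | c′ , b′ , b≤b′ , bs′ =
      conj c c′ (λ (v∈ , v∈′) → <-irrefl refl
        (<-≤-trans (proj₁ (All.lookup bs′ v∈′)) (proj₂ (All.lookup bs v∈))))
    , b′ , ≤-trans a≤b b≤b′
    , ++⁺ (All.map (λ (l , u) → l , ≤-trans u b≤b′) bs)
          (All.map (λ (l , u) → ≤-<-trans a≤b l , u) bs′)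

-- Out-trees with an unlabelled root: a node is the list of its children, each
-- paired with its label.
data Tree (A : Set) : Set where
  node : List (A × Tree A) → Tree A

children : {A : Set} → Tree A → List (A × Tree A)
children (node ts) = ts

tree : {φ : Form n At} → DBI φ → Tree (Fin n)
tree (B-prop i _) = node ((i , node []) ∷ [])
tree (B-∧ i _ d)  = node ((i , tree d) ∷ [])
tree (conj d e)   = node (children (tree d) ++ children (tree e))
tree (B i d)      = node ((i , tree d) ∷ [])

data RootPath {A : Set} : Tree A → Set where
  []  : ∀ {t} → RootPath t
  _∷_ : ∀ {a t ts} → (a , t) ∈ ts → RootPath t → RootPath (node ts)

RootP : {φ : Form n At} → DBI φ → Set
RootP d = RootPath (tree d)

agSeq : {A : Set} {t : Tree A} → RootPath t → List A
agSeq []                = []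
agSeq (_∷_ {a = a} _ σ) = a ∷ agSeq σ

module _ (F : Frame n) where
  open Frame F

  Cluster : World → List (Fin n) → Pred World 0ℓ
  Cluster w []      u = u ≡ w
  Cluster w (i ∷ s) u = ∃[ v ] R i w v × Cluster v s u

  Privatized : World → {φ : Form n At} → DBI φ → Set
  Privatized w d = (σ : RootP d) →
      Satisfiable (Cluster w (agSeq σ))
    × (∀ s → Linked _≢_ s → s ≢ agSeq σ →
         Cluster w (agSeq σ) Pred.⊥ Cluster w s)

{-# OPTIONS --safe #-}
-- Apart from the sink -1, every event is reached from 0 by at most one agent
-- sequence without successive repetitions: a prefix event m is entered from 0
-- by i only, the i-loop at m cannot be used again, and leaving m by another
-- agent is like leaving 0 in the smaller model, while in a conjunction the
-- first step decides on one of two disjoint components. Normality is needed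
-- only for the paths of the tree: along them no agent repeats and the sink is
-- never entered, since an agent steps from 0 to a positive event only if it is
-- a target agent.
module Submission where

open import Defs
open import Data.Empty using (⊥-elim)
open import Data.Fin using (Fin)
import Data.Fin.Properties as Fin
open import Data.Fin.Subset as Subset using (Subset; ⁅_⁆; _∪_; _∩_; Empty)
open import Data.Fin.Subset.Properties using (x∈⁅x⁆; x∈p∪q⁺; x∈p∩q⁺; ∩-comm)
open import Data.Integer as ℤ using (ℤ; 0ℤ; -1ℤ)
open import Data.Integer.Properties using (<-irrefl)
open import Data.Irrelevant using ([_])
open import Data.List using (List; []; _∷_; _++_)
open import Data.List.Membership.Propositional using (_∈_) renaming (_∉_ to _∉ˡ_)
open import Data.List.Membership.Propositional.Properties using (∈-++⁺ˡ; ∈-++⁺ʳ; ∈-++⁻)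
open import Data.List.Relation.Binary.Disjoint.Propositional using (Disjoint)
open import Data.List.Relation.Unary.Any using (here; there)
open import Data.List.Relation.Unary.Linked as Linked using (Linked; []; [-]; _∷_)
open import Data.Nat using (ℕ; _<_)
open import Data.Product using (∃-syntax; _×_; _,_; proj₁; proj₂; map₂; swap)
open import Data.Refinement using (_,_; value)
open import Data.Sum as Sum using (_⊎_; inj₁; inj₂)
open import Data.Unit using (⊤; tt)
open import Function using (id; _∘_; _⇔_; mk⇔; Equivalence)
open import Level using (0ℓ)
open import Relation.Binary using (Rel)
open import Relation.Binary.PropositionalEquality using (_≡_; _≢_; refl; sym; trans; cong; subst)
open import Relation.Nullary using (¬_; yes; no)
open import Relation.Unary using (Pred; Satisfiable)

private
  variable
    n          : ℕ
    At         : Set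
    φ          : Form n At
    i j        : Fin n
    m x y u    : ℤ
    s t        : List (Fin n)
    xs xs′     : List ℤ
    A A′       : Subset n

-- Clusters as labelled paths, and their transport

Relations : ℕ → Set₁
Relations n = Fin n → Rel ℤ 0ℓ

private
  variable
    Q Q′ : Relations n

-- The predicate `P` is an invariant carried along the path, so edges need a counterpart only where
-- `P` holds. This permits transport between relations that agree on just a region. The map `f`
-- serves the final passage from events to integers.
cluster-map : (F G : Frame n) (f : Frame.World F → Frame.World G) (P : Pred (Frame.World F) 0ℓ) →
  (∀ {j x y} → P x → Frame.R F j x y → Frame.R G j (f x) (f y) × P y) →
  ∀ s {w u} → P w → Cluster F w s u → Cluster G (f w) s (f u) × P u
cluster-map F G f P step []      Pw refl        = refl , Pw
cluster-map F G f P step (j ∷ s) Pw (v , r , c) with step Pw r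
... | r′ , Pv with cluster-map F G f P step s Pv c
...   | c′ , Pu = (f v , r′ , c′) , Pu

Path : Relations n → ℤ → List (Fin n) → ℤ → Set
Path Q = Cluster (record { World = ℤ ; R = Q })

path-map : (P : Pred ℤ 0ℓ) → (∀ {j x y} → P x → Q j x y → Q′ j x y × P y) →
           ∀ s → P x → Path Q x s u → Path Q′ x s u × P u
path-map {Q = Q} {Q′ = Q′} P step s = cluster-map (record { R = Q }) (record { R = Q′ }) id P step s

path-mono : (∀ {j x y} → Q j x y → Q′ j x y) → ∀ s → Path Q x s u → Path Q′ x s u
path-mono sub s = proj₁ ∘ path-map (λ _ → ⊤) (λ _ q → sub q , tt) s tt

-- Invariants of the recursive construction

Inner : List ℤ → Pred ℤ 0ℓ
Inner xs x = x ≡ -1ℤ ⊎ x ∈ xs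

inner∧≢-1⇒∈ : Inner xs x → x ≢ -1ℤ → x ∈ xs
inner∧≢-1⇒∈ (inj₁ x≡) x≢ = ⊥-elim (x≢ x≡)
inner∧≢-1⇒∈ (inj₂ x∈) _  = x∈

0<⇒≢0 : 0ℤ ℤ.< x → x ≢ 0ℤ
0<⇒≢0 0<x refl = <-irrefl refl 0<x

0<⇒≢-1 : 0ℤ ℤ.< x → x ≢ -1ℤ
0<⇒≢-1 () refl

-- The induction hypothesis, with `A` standing for the target agents. `target` says that no edge
-- returns to `0ℤ`. `unique` has to exclude `-1ℤ`, where many sequences end. `loop` is there because
-- conjuncts share the sink: a sink edge of one must also be an edge of the other. `initial` turns
-- disjointness of target sets into disjointness of first steps.
record Admissible {n} (Q : Relations n) (xs : List ℤ) (A : Subset n) : Set where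
  field
    positive : x ∈ xs → 0ℤ ℤ.< x
    source   : Q j x y → x ≡ 0ℤ ⊎ Inner xs x
    target   : Q j x y → Inner xs y
    sink     : Q j -1ℤ y → y ≡ -1ℤ
    loop     : ∀ j → Q j -1ℤ -1ℤ
    initial  : Q j 0ℤ y → y ∈ xs → j Subset.∈ A
    unique   : Linked _≢_ s → Linked _≢_ t → u ≢ -1ℤ →
               Path Q 0ℤ s u → Path Q 0ℤ t u → s ≡ t

  ∈⇒≢0 : x ∈ xs → x ≢ 0ℤ
  ∈⇒≢0 = 0<⇒≢0 ∘ positive

  ∈⇒≢-1 : x ∈ xs → x ≢ -1ℤ
  ∈⇒≢-1 = 0<⇒≢-1 ∘ positive

  inner⇒≢0 : Inner xs x → x ≢ 0ℤ
  inner⇒≢0 (inj₁ refl) ()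
  inner⇒≢0 (inj₂ x∈)   = ∈⇒≢0 x∈

  path-sink : ∀ s → Path Q -1ℤ s u → u ≡ -1ℤ
  path-sink s = proj₂ ∘ path-map {Q′ = Q} (_≡ -1ℤ) (λ { refl q → q , sink q }) s refl

-- What a path of the syntactic tree adds to `Admissible`: a nonempty cluster, and endpoints that
-- all lie in the range of `unique`.
Reach : Relations n → List (Fin n) → Set
Reach Q s = Satisfiable (Path Q 0ℤ s) × (∀ {u} → Path Q 0ℤ s u → u ≢ -1ℤ)

reach-[] : ∀ (Q : Relations n) → Reach Q []
reach-[] _ = (0ℤ , refl) , λ { refl () }

module _ (eq : ∀ {j x y} → Q j x y ⇔ Q′ j x y) where
  private
    to : Q j x y → Q′ j x y
    to = Equivalence.to eq

    from : Q′ j x y → Q j x y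
    from = Equivalence.from eq

  admissible-resp : Admissible Q xs A → Admissible Q′ xs A
  admissible-resp adm = record
    { positive = positive
    ; source   = source ∘ from
    ; target   = target ∘ from
    ; sink     = sink ∘ from
    ; loop     = to ∘ loop
    ; initial  = initial ∘ from
    ; unique   = λ {s} {t} ls lt u≢ p q →
        unique ls lt u≢ (path-mono from s p) (path-mono from t q)
    }
    where open Admissible adm

  reach-resp : ∀ s → Reach Q s → Reach Q′ s
  reach-resp s ((u , p) , ≢-1) = (u , path-mono to s p) , ≢-1 ∘ path-mono from s

-- Prefixing a belief operator

module Prefix {n} {Q : Relations n} {xs A} (adm : Admissible Q xs A)
              (i : Fin n) (m : ℤ) (0<m : 0ℤ ℤ.< m) (m∉ : m ∉ˡ xs) where
  open Admissible adm

  private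
    Q⁺ : Relations n
    Q⁺ = prefixQ i m Q

    m≢0 : m ≢ 0ℤ
    m≢0 = 0<⇒≢0 0<m

    m≢-1 : m ≢ -1ℤ
    m≢-1 = 0<⇒≢-1 0<m

    m∉inner : ¬ Inner xs m
    m∉inner = Sum.[ m≢-1 , m∉ ]

    -- Every edge added by the prefix starts at `0ℤ` or `m`, and neither is an inner point of the
    -- smaller model.
    step⁻ : Inner xs x → Q⁺ j x y → Q j x y × Inner xs y
    step⁻ ix (inj₁ (q , _))                        = q , target q
    step⁻ ix (inj₂ (inj₁ (_ , inj₁ (x≡0 , _))))    = ⊥-elim (inner⇒≢0 ix x≡0)
    step⁻ ix (inj₂ (inj₁ (_ , inj₂ (refl , _))))   = ⊥-elim (m∉inner ix)
    step⁻ ix (inj₂ (inj₂ (_ , here refl)))         = ⊥-elim (inner⇒≢0 ix refl)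
    step⁻ ix (inj₂ (inj₂ (_ , there (here refl)))) = ⊥-elim (m∉inner ix)

    step⁺ : Inner xs x → Q j x y → Q⁺ j x y × Inner xs y
    step⁺ ix q = inj₁ (q , inner⇒≢0 ix , inner⇒≢0 (target q)) , target q

    from-0 : Q⁺ j 0ℤ y → y ≢ -1ℤ → j ≡ i × y ≡ m
    from-0 (inj₁ (_ , 0≢0 , _))                      _ = ⊥-elim (0≢0 refl)
    from-0 (inj₂ (inj₁ (_ , inj₁ (_ , y≡))))       y≢ = ⊥-elim (y≢ y≡)
    from-0 (inj₂ (inj₁ (_ , inj₂ (0≡m , _))))        _ = ⊥-elim (m≢0 (sym 0≡m))
    from-0 (inj₂ (inj₂ (j≡i , here refl)))           _ = j≡i , refl
    from-0 (inj₂ (inj₂ (_ , there (here refl))))     _ = ⊥-elim (m≢0 refl)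

    -- Freshness of `m` and `source` rule out old edges leaving `m`, and the loop at `m` belongs to
    -- `i`; only the copied edges of `0ℤ` remain.
    from-m : i ≢ j → Q⁺ j m y → Q j 0ℤ y
    from-m i≢j (inj₁ (q , m≢0 , _))                = ⊥-elim (Sum.[ m≢0 , m∉inner ] (source q))
    from-m i≢j (inj₂ (inj₁ (_ , inj₁ (m≡0 , _))))  = ⊥-elim (m≢0 m≡0)
    from-m i≢j (inj₂ (inj₁ (_ , inj₂ (_ , q))))    = q
    from-m i≢j (inj₂ (inj₂ (j≡i , _)))             = ⊥-elim (i≢j (sym j≡i))

    -- Linkedness of `i ∷ s` forbids the loop at `m`. After a copied first step the path is inside
    -- the smaller model and cannot come back to `m`.
    path-from-m : Linked _≢_ (i ∷ s) → Path Q⁺ m s u →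
                  (s ≡ [] × u ≡ m) ⊎ (Path Q 0ℤ s u × Inner xs u)
    path-from-m [-]       refl        = inj₁ (refl , refl)
    path-from-m (i≢j ∷ _) (v , r , p) =
      let q       = from-m i≢j r
          p′ , iu = path-map (Inner xs) step⁻ _ (target q) p
      in inj₂ ((v , q , p′) , iu)

    sink⁺ : Q⁺ j -1ℤ y → y ≡ -1ℤ
    sink⁺ = sink ∘ proj₁ ∘ step⁻ (inj₁ refl)

    path-sink⁺ : ∀ s → Path Q⁺ -1ℤ s u → u ≡ -1ℤ
    path-sink⁺ s = path-sink s ∘ proj₁ ∘ path-map (Inner xs) step⁻ s (inj₁ refl)

    -- The three outcomes have distinct endpoints, namely `0ℤ`, `m` and members of `xs`, so two
    -- paths with a common endpoint always fall under the same one.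
    path-from-0 : Linked _≢_ s → u ≢ -1ℤ → Path Q⁺ 0ℤ s u →
      (s ≡ [] × u ≡ 0ℤ) ⊎
      ∃[ t ] s ≡ i ∷ t × ((t ≡ [] × u ≡ m) ⊎ (Linked _≢_ t × Path Q 0ℤ t u × u ∈ xs))
    path-from-0 {s = []}    l u≢ refl        = inj₁ (refl , refl)
    -- A first step into the sink could never be left again, so it contradicts `u≢`.
    path-from-0 {s = j ∷ s} l u≢ (v , r , p) with from-0 r (λ { refl → u≢ (path-sink⁺ s p) })
    ... | refl , refl = inj₂ (s , refl ,
      Sum.map₂ (λ (p′ , iu) → Linked.tail l , p′ , inner∧≢-1⇒∈ iu u≢) (path-from-m l p))

    unique⁺ : Linked _≢_ s → Linked _≢_ t → u ≢ -1ℤ →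
              Path Q⁺ 0ℤ s u → Path Q⁺ 0ℤ t u → s ≡ t
    unique⁺ ls lt u≢ p q with path-from-0 ls u≢ p | path-from-0 lt u≢ q
    ... | inj₁ (refl , _)    | inj₁ (refl , _) = refl
    ... | inj₁ (_ , refl)    | inj₂ (_ , _ , inj₁ (_ , 0≡m)) = ⊥-elim (m≢0 (sym 0≡m))
    ... | inj₁ (_ , refl)    | inj₂ (_ , _ , inj₂ (_ , _ , 0∈)) = ⊥-elim (∈⇒≢0 0∈ refl)
    ... | inj₂ (_ , _ , inj₁ (_ , 0≡m))    | inj₁ (_ , refl) = ⊥-elim (m≢0 (sym 0≡m))
    ... | inj₂ (_ , _ , inj₂ (_ , _ , 0∈)) | inj₁ (_ , refl) = ⊥-elim (∈⇒≢0 0∈ refl)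
    ... | inj₂ (_ , refl , inj₁ (refl , _)) | inj₂ (_ , refl , inj₁ (refl , _)) = refl
    ... | inj₂ (_ , _ , inj₁ (_ , refl))   | inj₂ (_ , _ , inj₂ (_ , _ , m∈)) = ⊥-elim (m∉ m∈)
    ... | inj₂ (_ , _ , inj₂ (_ , _ , m∈)) | inj₂ (_ , _ , inj₁ (_ , refl))   = ⊥-elim (m∉ m∈)
    ... | inj₂ (_ , refl , inj₂ (ls′ , p′ , _)) | inj₂ (_ , refl , inj₂ (lt′ , q′ , _)) =
      cong (i ∷_) (unique ls′ lt′ u≢ p′ q′)

    positive⁺ : x ∈ m ∷ xs → 0ℤ ℤ.< x
    positive⁺ (here refl) = 0<m
    positive⁺ (there x∈)  = positive x∈

    source⁺ : Q⁺ j x y → x ≡ 0ℤ ⊎ Inner (m ∷ xs) x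
    source⁺ (inj₁ (q , _))                        = Sum.map₂ (Sum.map₂ there) (source q)
    source⁺ (inj₂ (inj₁ (_ , inj₁ (x≡0 , _))))    = inj₁ x≡0
    source⁺ (inj₂ (inj₁ (_ , inj₂ (x≡m , _))))    = inj₂ (inj₂ (here x≡m))
    source⁺ (inj₂ (inj₂ (_ , here refl)))         = inj₁ refl
    source⁺ (inj₂ (inj₂ (_ , there (here refl)))) = inj₂ (inj₂ (here refl))

    target⁺ : Q⁺ j x y → Inner (m ∷ xs) y
    target⁺ (inj₁ (q , _))                        = Sum.map₂ there (target q)
    target⁺ (inj₂ (inj₁ (_ , inj₁ (_ , y≡-1))))   = inj₁ y≡-1
    target⁺ (inj₂ (inj₁ (_ , inj₂ (_ , q))))      = Sum.map₂ there (target q)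
    target⁺ (inj₂ (inj₂ (_ , here refl)))         = inj₂ (here refl)
    target⁺ (inj₂ (inj₂ (_ , there (here refl)))) = inj₂ (here refl)

    initial⁺ : Q⁺ j 0ℤ y → y ∈ m ∷ xs → j Subset.∈ ⁅ i ⁆
    initial⁺ q y∈ with from-0 q (0<⇒≢-1 (positive⁺ y∈))
    ... | refl , _ = x∈⁅x⁆ i

  admissible : Admissible Q⁺ (m ∷ xs) ⁅ i ⁆
  admissible = record
    { positive = positive⁺
    ; source   = source⁺
    ; target   = target⁺
    ; sink     = sink⁺
    ; loop     = λ j → proj₁ (step⁺ (inj₁ refl) (loop j))
    ; initial  = initial⁺
    ; unique   = unique⁺
    }

  reach : Linked _≢_ (i ∷ s) → Reach Q s → Reach Q⁺ (i ∷ s)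
  reach {s} l (sat , ≢-1) = map₂ (λ p → m , inj₂ (inj₂ (refl , here refl)) , p) (continue l sat) , avoid
    where
    continue : ∀ {s} → Linked _≢_ (i ∷ s) → Satisfiable (Path Q 0ℤ s) → Satisfiable (Path Q⁺ m s)
    -- The empty sequence ends at `m` in place of `0ℤ`; a nonempty one keeps its endpoint.
    continue [-]       _                 = m , refl
    continue (i≢j ∷ _) (u , v , q , p) = u , v ,
      inj₂ (inj₁ (i≢j ∘ sym , inj₂ (refl , q))) ,
      proj₁ (path-map (Inner xs) step⁺ _ (target q) p)

    avoid : Path Q⁺ 0ℤ (i ∷ s) u → u ≢ -1ℤ
    avoid (v , inj₁ (_ , 0≢0 , _) , _)                    = ⊥-elim (0≢0 refl)
    avoid (v , inj₂ (inj₁ (i≢i , _)) , _)                 = ⊥-elim (i≢i refl)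
    avoid (v , inj₂ (inj₂ (_ , there (here refl))) , _)   = ⊥-elim (m≢0 refl)
    -- The first step by `i` must enter `m`; the rest either stops there or follows `s` in the
    -- smaller model, where the sink is already avoided.
    avoid (v , inj₂ (inj₂ (_ , here refl)) , p) with path-from-m l p
    ... | inj₁ (_ , refl) = m≢-1
    ... | inj₂ (p′ , _)   = ≢-1 p′

-- Base case: belief in a propositional formula

-- Makes the model of B i ξ an instance of the prefix construction.
trivialQ : Relations n
trivialQ _ x y = (x ≡ 0ℤ ⊎ x ≡ -1ℤ) × y ≡ -1ℤ

-- Every edge enters the sink, so a path that ends elsewhere has taken no step.
trivial-admissible : Admissible {n} trivialQ [] Subset.⊥
trivial-admissible = record
  { positive = λ ()
  ; source   = λ (x≡ , _) → Sum.map₂ inj₁ x≡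
  ; target   = inj₁ ∘ proj₂
  ; sink     = proj₂
  ; loop     = λ _ → inj₂ refl , refl
  ; initial  = λ _ ()
  ; unique   = λ _ _ u≢ p q → trans (no-step u≢ p) (sym (no-step u≢ q))
  }
  where
  no-step : u ≢ -1ℤ → Path trivialQ 0ℤ s u → s ≡ []
  no-step {s = []}    _  _                    = refl
  no-step {s = _ ∷ s} u≢ (_ , (_ , refl) , p) =
    ⊥-elim (u≢ (proj₂ (path-map (_≡ -1ℤ) (λ _ q → q , proj₂ q) s refl p)))

-- The loop at the sink is the only edge surviving `underline`, and `(m , -1ℤ)` is the copy of the
-- trivial edge from `0ℤ` to the sink.
prefix-trivial : {At : Set} (i : Fin n) {ξ : Form n At} (π : Propositional ξ) (0<m : 0ℤ ℤ.< m) →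
                 prefixQ i m trivialQ j x y ⇔ Qᶻ (B-prop {i = i} {π = π} m 0<m) j x y
prefix-trivial {m = m} {j = j} {x} {y} i π 0<m = mk⇔ to from
  where
  to : prefixQ i m trivialQ j x y → Qᶻ (B-prop {i = i} {π = π} m 0<m) j x y
  to (inj₁ ((inj₁ refl , _) , 0≢0 , _)) = ⊥-elim (0≢0 refl)
  -- `Qᶻ` lists the sink loop once for `j ≢ i` and once for `j ≡ i`, so deciding equality of agents
  -- selects the disjunct.
  to (inj₁ ((inj₂ refl , refl) , _)) with j Fin.≟ i
  ... | yes j≡i = inj₂ (j≡i , there (there (here refl)))
  ... | no  j≢i = inj₁ (j≢i , there (there (here refl)))
  to (inj₂ (inj₁ (j≢i , inj₁ (refl , refl))))       = inj₁ (j≢i , here refl)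
  to (inj₂ (inj₁ (j≢i , inj₂ (refl , _ , refl))))   = inj₁ (j≢i , there (here refl))
  to (inj₂ (inj₂ (j≡i , here refl)))                = inj₂ (j≡i , here refl)
  to (inj₂ (inj₂ (j≡i , there (here refl))))        = inj₂ (j≡i , there (here refl))

  from : Qᶻ (B-prop {i = i} {π = π} m 0<m) j x y → prefixQ i m trivialQ j x y
  from (inj₁ (j≢i , here refl))                 = inj₂ (inj₁ (j≢i , inj₁ (refl , refl)))
  from (inj₁ (j≢i , there (here refl)))         = inj₂ (inj₁ (j≢i , inj₂ (refl , inj₁ refl , refl)))
  from (inj₁ (_ , there (there (here refl))))   = inj₁ ((inj₂ refl , refl) , (λ ()) , (λ ()))
  from (inj₂ (j≡i , here refl))                 = inj₂ (inj₂ (j≡i , here refl))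
  from (inj₂ (j≡i , there (here refl)))         = inj₂ (inj₂ (j≡i , there (here refl)))
  from (inj₂ (_ , there (there (here refl))))   = inj₁ ((inj₂ refl , refl) , (λ ()) , (λ ()))

-- Conjunction: merging two models at `0ℤ` and `-1ℤ`

Initial : Relations n → List ℤ → Relations n → List ℤ → Fin n → Pred ℤ 0ℓ
Initial Q xs Q′ xs′ j k = (Q j 0ℤ k ⊎ Q′ j 0ℤ k) × k ∈ xs ++ xs′

-- Qᶻ (conj c c′) unfolds to mergeQ (Qᶻ c) (D c) (Qᶻ c′) (D c′).
mergeQ : Relations n → List ℤ → Relations n → List ℤ → Relations n
mergeQ Q xs Q′ xs′ j x y =
    underline (Q j) x y
  ⊎ underline (Q′ j) x y
  ⊎ (x ≡ 0ℤ × Initial Q xs Q′ xs′ j y)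
  ⊎ (x ≡ 0ℤ × y ≡ -1ℤ × ¬ (∃[ k ] Initial Q xs Q′ xs′ j k))

initial-swap : ∀ (Q : Relations n) xs Q′ xs′ → Initial Q xs Q′ xs′ j x → Initial Q′ xs′ Q xs j x
initial-swap Q xs Q′ xs′ (q , k∈) = Sum.swap q , Sum.[ ∈-++⁺ʳ xs′ , ∈-++⁺ˡ ] (∈-++⁻ xs k∈)

-- This symmetry lets results about the left component be reused for the right one.
merge-swap : ∀ (Q : Relations n) xs Q′ xs′ → mergeQ Q xs Q′ xs′ j x y → mergeQ Q′ xs′ Q xs j x y
merge-swap Q xs Q′ xs′ (inj₁ q)                          = inj₂ (inj₁ q)
merge-swap Q xs Q′ xs′ (inj₂ (inj₁ q))                   = inj₁ q
merge-swap Q xs Q′ xs′ (inj₂ (inj₂ (inj₁ (x≡0 , k)))) =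
  inj₂ (inj₂ (inj₁ (x≡0 , initial-swap Q xs Q′ xs′ k)))
merge-swap Q xs Q′ xs′ (inj₂ (inj₂ (inj₂ (x≡0 , y≡-1 , none)))) =
  inj₂ (inj₂ (inj₂ (x≡0 , y≡-1 , none ∘ map₂ (initial-swap Q′ xs′ Q xs))))

module Component {n} {Q Q′ : Relations n} {xs xs′ A A′}
                 (adm : Admissible Q xs A) (adm′ : Admissible Q′ xs′ A′)
                 (dis : Disjoint xs xs′) where
  open Admissible adm
  private
    module ′ = Admissible adm′

    Q⁺ : Relations n
    Q⁺ = mergeQ Q xs Q′ xs′

  -- The inner points common to both components reduce to the sink. An edge of `Q′` leaving an inner
  -- point of `Q` thus leaves the sink, `′.sink` makes it a loop, and `loop` provides the same edge
  -- in `Q`.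
  step⁻ : Inner xs x → Q⁺ j x y → Q j x y × Inner xs y
  step⁻ ix (inj₁ (q , _)) = q , target q
  step⁻ {j = j} ix (inj₂ (inj₁ (q , x≢0 , _))) with ′.source q | ix
  ... | inj₁ x≡0         | _           = ⊥-elim (x≢0 x≡0)
  ... | inj₂ (inj₂ x∈′)  | inj₂ x∈     = ⊥-elim (dis (x∈ , x∈′))
  ... | inj₂ (inj₂ -1∈′) | inj₁ refl   = ⊥-elim (′.∈⇒≢-1 -1∈′ refl)
  ... | inj₂ (inj₁ refl) | _ with ′.sink q
  ...   | refl = loop j , inj₁ refl
  step⁻ ix (inj₂ (inj₂ (inj₁ (x≡0 , _)))) = ⊥-elim (inner⇒≢0 ix x≡0)
  step⁻ ix (inj₂ (inj₂ (inj₂ (x≡0 , _)))) = ⊥-elim (inner⇒≢0 ix x≡0)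

  step⁺ : Inner xs x → Q j x y → Q⁺ j x y × Inner xs y
  step⁺ ix q = inj₁ (q , inner⇒≢0 ix , inner⇒≢0 (target q)) , target q

  path⁻ : ∀ s → Inner xs x → Path Q⁺ x s u → Path Q x s u × Inner xs u
  path⁻ = path-map (Inner xs) step⁻

  path⁺ : ∀ s → Inner xs x → Path Q x s u → Path Q⁺ x s u × Inner xs u
  path⁺ = path-map (Inner xs) step⁺

  -- Only the first step can differ from `Q`. The agent `j` taking it already has a positive
  -- successor in `Q`, so the fallback edge to the sink is absent; a step into the other component
  -- would make `j` a target agent of both conjuncts.
  reach : Empty (A ∩ A′) → ∀ s → Reach Q s → Reach Q⁺ s
  reach A∩A′ []      _ = reach-[] Q⁺
  reach A∩A′ (j ∷ s) ((u , v , q , p) , ≢-1) =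
    (u , v , inj₂ (inj₂ (inj₁ (refl , init))) , proj₁ (path⁺ s (target q) p)) , avoid
    where
    v∈ : v ∈ xs
    -- If `v` were the sink, the whole given path would end there, against `≢-1`.
    v∈ = inner∧≢-1⇒∈ (target q) λ { refl → ≢-1 (v , q , p) (path-sink s p) }

    init : Initial Q xs Q′ xs′ j v
    init = inj₁ q , ∈-++⁺ˡ v∈

    avoid : ∀ {u} → Path Q⁺ 0ℤ (j ∷ s) u → u ≢ -1ℤ
    avoid (_ , inj₁ (_ , 0≢0 , _) , _)                      = ⊥-elim (0≢0 refl)
    avoid (_ , inj₂ (inj₁ (_ , 0≢0 , _)) , _)               = ⊥-elim (0≢0 refl)
    avoid (_ , inj₂ (inj₂ (inj₂ (_ , _ , none))) , _)       = ⊥-elim (none (v , init))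
    avoid (w , inj₂ (inj₂ (inj₁ (_ , inj₁ r , _))) , p′)    =
      ≢-1 (w , r , proj₁ (path⁻ s (target r) p′))
    avoid (w , inj₂ (inj₂ (inj₁ (_ , inj₂ r , w∈))) , _) with ′.target r
    ... | inj₂ w∈′  = ⊥-elim (A∩A′ (j , x∈p∩q⁺ (initial q v∈ , ′.initial r w∈′)))
    ... | inj₁ refl = ⊥-elim (Sum.[ (λ -1∈ → ∈⇒≢-1 -1∈ refl) , (λ -1∈ → ′.∈⇒≢-1 -1∈ refl) ] (∈-++⁻ xs w∈))

module Merge {n} {Q Q′ : Relations n} {xs xs′ A A′}
             (adm : Admissible Q xs A) (adm′ : Admissible Q′ xs′ A′)
             (dis : Disjoint xs xs′) where
  open Admissible adm
  private
    module ′ = Admissible adm′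
    module L = Component adm adm′ dis
    module R = Component adm′ adm (dis ∘ swap)

    Q⁺ : Relations n
    Q⁺ = mergeQ Q xs Q′ xs′

    to-swap : Q⁺ j x y → mergeQ Q′ xs′ Q xs j x y
    to-swap = merge-swap Q xs Q′ xs′

    from-swap : mergeQ Q′ xs′ Q xs j x y → Q⁺ j x y
    from-swap = merge-swap Q′ xs′ Q xs

    -- The first step chooses a component, which the path then cannot leave. By disjointness the
    -- endpoint reveals the choice, so `unique⁺` never has to compare paths from different
    -- components.
    path-from-0 : ∀ s → u ≢ -1ℤ → Path Q⁺ 0ℤ s u →
      (s ≡ [] × u ≡ 0ℤ) ⊎ (Path Q 0ℤ s u × u ∈ xs) ⊎ (Path Q′ 0ℤ s u × u ∈ xs′)
    path-from-0 []      u≢ refl = inj₁ (refl , refl)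
    path-from-0 (j ∷ s) u≢ (v , inj₁ (_ , 0≢0 , _) , p)        = ⊥-elim (0≢0 refl)
    path-from-0 (j ∷ s) u≢ (v , inj₂ (inj₁ (_ , 0≢0 , _)) , p) = ⊥-elim (0≢0 refl)
    -- The sink lies in both components; the rest of the path is read in the left one.
    path-from-0 (j ∷ s) u≢ (v , inj₂ (inj₂ (inj₂ (_ , refl , _))) , p) =
      ⊥-elim (u≢ (path-sink s (proj₁ (L.path⁻ s (inj₁ refl) p))))
    path-from-0 (j ∷ s) u≢ (v , inj₂ (inj₂ (inj₁ (_ , inj₁ q , _))) , p) =
      let p′ , iu = L.path⁻ s (target q) p
      in inj₂ (inj₁ ((v , q , p′) , inner∧≢-1⇒∈ iu u≢))
    path-from-0 (j ∷ s) u≢ (v , inj₂ (inj₂ (inj₁ (_ , inj₂ q , _))) , p) =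
      -- `R` speaks of the merge with its components exchanged, so the path is first carried over by
      -- `to-swap`.
      let p′ , iu = R.path⁻ s (′.target q) (path-mono to-swap s p)
      in inj₂ (inj₂ ((v , q , p′) , inner∧≢-1⇒∈ iu u≢))

    unique⁺ : Linked _≢_ s → Linked _≢_ t → u ≢ -1ℤ →
              Path Q⁺ 0ℤ s u → Path Q⁺ 0ℤ t u → s ≡ t
    unique⁺ {s} {t} ls lt u≢ p q with path-from-0 s u≢ p | path-from-0 t u≢ q
    ... | inj₁ (refl , _)       | inj₁ (refl , _)       = refl
    ... | inj₁ (_ , refl)       | inj₂ (inj₁ (_ , 0∈))  = ⊥-elim (∈⇒≢0 0∈ refl)
    ... | inj₁ (_ , refl)       | inj₂ (inj₂ (_ , 0∈))  = ⊥-elim (′.∈⇒≢0 0∈ refl)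
    ... | inj₂ (inj₁ (_ , 0∈))  | inj₁ (_ , refl)       = ⊥-elim (∈⇒≢0 0∈ refl)
    ... | inj₂ (inj₂ (_ , 0∈))  | inj₁ (_ , refl)       = ⊥-elim (′.∈⇒≢0 0∈ refl)
    ... | inj₂ (inj₁ (p′ , _))  | inj₂ (inj₁ (q′ , _))  = unique ls lt u≢ p′ q′
    ... | inj₂ (inj₂ (p′ , _))  | inj₂ (inj₂ (q′ , _))  = ′.unique ls lt u≢ p′ q′
    ... | inj₂ (inj₁ (_ , u∈))  | inj₂ (inj₂ (_ , u∈′)) = ⊥-elim (dis (u∈ , u∈′))
    ... | inj₂ (inj₂ (_ , u∈′)) | inj₂ (inj₁ (_ , u∈))  = ⊥-elim (dis (u∈ , u∈′))

    innerˡ : Inner xs x → Inner (xs ++ xs′) x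
    innerˡ = Sum.map₂ ∈-++⁺ˡ

    innerʳ : Inner xs′ x → Inner (xs ++ xs′) x
    innerʳ = Sum.map₂ (∈-++⁺ʳ xs)

    source⁺ : Q⁺ j x y → x ≡ 0ℤ ⊎ Inner (xs ++ xs′) x
    source⁺ (inj₁ (q , _))                  = Sum.map₂ innerˡ (source q)
    source⁺ (inj₂ (inj₁ (q , _)))           = Sum.map₂ innerʳ (′.source q)
    source⁺ (inj₂ (inj₂ (inj₁ (x≡0 , _))))  = inj₁ x≡0
    source⁺ (inj₂ (inj₂ (inj₂ (x≡0 , _))))  = inj₁ x≡0

    target⁺ : Q⁺ j x y → Inner (xs ++ xs′) y
    target⁺ (inj₁ (q , _))                      = innerˡ (target q)
    target⁺ (inj₂ (inj₁ (q , _)))               = innerʳ (′.target q)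
    target⁺ (inj₂ (inj₂ (inj₁ (_ , _ , y∈))))   = inj₂ y∈
    target⁺ (inj₂ (inj₂ (inj₂ (_ , y≡-1 , _)))) = inj₁ y≡-1

    positive⁺ : x ∈ xs ++ xs′ → 0ℤ ℤ.< x
    positive⁺ = Sum.[ positive , ′.positive ] ∘ ∈-++⁻ xs

    initial⁺ : Q⁺ j 0ℤ y → y ∈ xs ++ xs′ → j Subset.∈ A ∪ A′
    initial⁺ (inj₁ (_ , 0≢0 , _))                      _  = ⊥-elim (0≢0 refl)
    initial⁺ (inj₂ (inj₁ (_ , 0≢0 , _)))               _  = ⊥-elim (0≢0 refl)
    initial⁺ (inj₂ (inj₂ (inj₂ (_ , refl , _))))       y∈ = ⊥-elim (0<⇒≢-1 (positive⁺ y∈) refl)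
    initial⁺ (inj₂ (inj₂ (inj₁ (_ , inj₁ q , _)))) y∈ =
      x∈p∪q⁺ (inj₁ (initial q (inner∧≢-1⇒∈ (target q) (0<⇒≢-1 (positive⁺ y∈)))))
    initial⁺ (inj₂ (inj₂ (inj₁ (_ , inj₂ q , _)))) y∈ =
      x∈p∪q⁺ (inj₂ (′.initial q (inner∧≢-1⇒∈ (′.target q) (0<⇒≢-1 (positive⁺ y∈)))))

  admissible : Admissible Q⁺ (xs ++ xs′) (A ∪ A′)
  admissible = record
    { positive = positive⁺
    ; source   = source⁺
    ; target   = target⁺
    ; sink     = sink ∘ proj₁ ∘ L.step⁻ (inj₁ refl)
    ; loop     = λ j → proj₁ (L.step⁺ (inj₁ refl) (loop j))
    ; initial  = initial⁺
    ; unique   = unique⁺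
    }

  reachˡ : Empty (A ∩ A′) → ∀ s → Reach Q s → Reach Q⁺ s
  reachˡ = L.reach

  reachʳ : Empty (A ∩ A′) → ∀ s → Reach Q′ s → Reach Q⁺ s
  reachʳ A∩A′ s = reach-resp (mk⇔ from-swap to-swap) s ∘
    R.reach (λ (k , k∈) → A∩A′ (k , subst (k Subset.∈_) (∩-comm A′ A) k∈)) s

-- Recursion over constructions, and paths of the syntactic tree

Qᶻ-admissible : {d : DBI φ} (c : Construction d) → Admissible (Qᶻ c) (D c) (ta φ)
Qᶻ-admissible (B-prop {i = i} {π = π} m 0<m) =
  admissible-resp (prefix-trivial i π 0<m) (Prefix.admissible trivial-admissible i m 0<m λ ())
Qᶻ-admissible (B-∧ {i = i} c m 0<m m∉) = Prefix.admissible (Qᶻ-admissible c) i m 0<m m∉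
Qᶻ-admissible (B {i = i} c m 0<m m∉)   = Prefix.admissible (Qᶻ-admissible c) i m 0<m m∉
Qᶻ-admissible (conj c c′ dis)          = Merge.admissible (Qᶻ-admissible c) (Qᶻ-admissible c′) dis

-- Identifying roots leaves everything below them intact, so the first edge decides the subtree. The
-- empty path is assigned to the left.
rootPath-++⁻ : ∀ {B : Set} (t t′ : Tree B) (σ : RootPath (node (children t ++ children t′))) →
               (∃[ τ ] agSeq {t = t} τ ≡ agSeq σ) ⊎ (∃[ τ ] agSeq {t = t′} τ ≡ agSeq σ)
rootPath-++⁻ (node ts) (node ts′) []       = inj₁ ([] , refl)
rootPath-++⁻ (node ts) (node ts′) (a∈ ∷ σ) with ∈-++⁻ ts a∈
... | inj₁ a∈ts  = inj₁ (a∈ts ∷ σ , refl)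
... | inj₂ a∈ts′ = inj₂ (a∈ts′ ∷ σ , refl)

-- Links the tree with `ta`: both see only the outermost modalities, and merged roots correspond to
-- unions.
child∈ta : (d : DBI φ) {t : Tree (Fin n)} → (j , t) ∈ children (tree d) → j Subset.∈ ta φ
child∈ta (B-prop i _) (here refl) = x∈⁅x⁆ i
child∈ta (B-∧ i _ _)  (here refl) = x∈⁅x⁆ i
child∈ta (B i _)      (here refl) = x∈⁅x⁆ i
child∈ta (conj d e)   j∈          =
  x∈p∪q⁺ (Sum.map (child∈ta d) (child∈ta e) (∈-++⁻ (children (tree d)) j∈))

linked-∷ : {t : Tree (Fin n)} → (∀ {j t′} → (j , t′) ∈ children t → i ≢ j) →
           (σ : RootPath t) → Linked _≢_ (agSeq σ) → Linked _≢_ (i ∷ agSeq σ)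
linked-∷ i≢ []       l = [-]
linked-∷ i≢ (j∈ ∷ σ) l = i≢ j∈ ∷ l

-- The agent following `i` labels a child of the root, hence lies in `ta φ`, while `i` does not.
normal-∷ : (d : DBI φ) → i Subset.∉ ta φ →
           (σ : RootP d) → Linked _≢_ (agSeq σ) → Linked _≢_ (i ∷ agSeq σ)
normal-∷ d i∉ = linked-∷ (λ { j∈ refl → i∉ (child∈ta d j∈) })

agSeq-linked : {d : DBI φ} → Normal d → (σ : RootP d) → Linked _≢_ (agSeq σ)
agSeq-linked B-prop             (here refl ∷ []) = [-]
agSeq-linked (B-∧ {d = d} N i∉) (here refl ∷ σ)  = normal-∷ d i∉ σ (agSeq-linked N σ)
agSeq-linked (B {d = d} N i∉)   (here refl ∷ σ)  = normal-∷ d i∉ σ (agSeq-linked N σ)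
agSeq-linked B-prop             []               = []
agSeq-linked (B-∧ _ _)          []               = []
agSeq-linked (B _ _)            []               = []
agSeq-linked (conj {d = d} {e} N N′ _) σ with rootPath-++⁻ (tree d) (tree e) σ
... | inj₁ (τ , eq) = subst (Linked _≢_) eq (agSeq-linked N τ)
... | inj₂ (τ , eq) = subst (Linked _≢_) eq (agSeq-linked N′ τ)

agSeq-reach : ∀ {n} {At : Set} {φ : Form n At} {d : DBI φ} → Normal d →
              (c : Construction d) (σ : RootP d) → Reach (Qᶻ c) (agSeq σ)
agSeq-reach {n} B-prop c@(B-prop {i = i} {π = π} m 0<m) (here refl ∷ []) =
  reach-resp {Q = prefixQ i m trivialQ} {Q′ = Qᶻ c} (prefix-trivial i π 0<m) (i ∷ [])
    (Prefix.reach trivial-admissible i m 0<m (λ ()) [-] (reach-[] (trivialQ {n})))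
agSeq-reach (B-∧ {i = i} {d = d} N i∉) (B-∧ c m 0<m m∉) (here refl ∷ σ) =
  Prefix.reach (Qᶻ-admissible c) i m 0<m m∉
    (normal-∷ d i∉ σ (agSeq-linked N σ)) (agSeq-reach N c σ)
agSeq-reach (B {i = i} {d = d} N i∉) (B c m 0<m m∉) (here refl ∷ σ) =
  Prefix.reach (Qᶻ-admissible c) i m 0<m m∉
    (normal-∷ d i∉ σ (agSeq-linked N σ)) (agSeq-reach N c σ)
agSeq-reach B-prop     c@(B-prop _ _)  [] = reach-[] (Qᶻ c)
agSeq-reach (B-∧ _ _)  c@(B-∧ _ _ _ _) [] = reach-[] (Qᶻ c)
agSeq-reach (B _ _)    c@(B _ _ _ _)   [] = reach-[] (Qᶻ c)
agSeq-reach (conj {d = d} {e} N N′ A∩A′) (conj c c′ dis) σ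
  with rootPath-++⁻ (tree d) (tree e) σ
... | inj₁ (τ , eq) = subst (Reach (Qᶻ (conj c c′ dis))) eq
  (Merge.reachˡ (Qᶻ-admissible c) (Qᶻ-admissible c′) dis A∩A′ (agSeq τ) (agSeq-reach N c τ))
... | inj₂ (τ , eq) = subst (Reach (Qᶻ (conj c c′ dis))) eq
  (Merge.reachʳ (Qᶻ-admissible c) (Qᶻ-admissible c′) dis A∩A′ (agSeq τ) (agSeq-reach N′ c′ τ))

-- From integers back to events

module _ {At : Set} (p : At) {φ : Form n At} {d : DBI φ} (c : Construction d) where
  private
    F = ActionModel.frame (𝒰 p c)

  -- `Qᶻ` relates arbitrary integers; closure under its edges lets a path starting at an event be
  -- lifted to events.
  target∈E : Qᶻ c j x y → y ∈ E c
  target∈E q with Admissible.target (Qᶻ-admissible c) q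
  ... | inj₁ refl = there (here refl)
  ... | inj₂ y∈   = there (there y∈)

  path⇒cluster : ∀ s {w} → Path (Qᶻ c) (value w) s u → Satisfiable (Cluster F w s)
  path⇒cluster []      {w} _           = w , refl
  path⇒cluster (j ∷ s) {w} (v , q , π) =
    map₂ (λ π′ → v′ , q , π′) (path⇒cluster s {v′} π)
    where
    v′ : EventOf c
    v′ = v , [ target∈E q ]

  cluster⇒path : ∀ s {w u} → Cluster F w s u → Path (Qᶻ c) (value w) s (value u)
  cluster⇒path s = proj₁ ∘ cluster-map F _ value (λ _ → ⊤) (λ _ q → q , tt) s tt

theorem8 : ∀ {n : ℕ} → 1 < n →
    {At : Set} (p : At) {φ : Form n At} (d : DBI φ) → Normal d →
    (c : Construction d) →
    Privatized (ActionModel.frame (𝒰 p c)) (0ᴱ c) d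
theorem8 _ p d N c σ =
    path⇒cluster p c (agSeq σ) (proj₂ sat)
  , λ s l s≢ (c₁ , c₂) →
      let p₁ = cluster⇒path p c (agSeq σ) c₁
          p₂ = cluster⇒path p c s c₂
      -- The common point lies in the cluster of a tree path, so `≢-1` keeps it off the sink and
      -- uniqueness applies.
      in s≢ (Admissible.unique (Qᶻ-admissible c) l (agSeq-linked N σ) (≢-1 p₁) p₂ p₁)
  where
  reach = agSeq-reach N c σ
  sat   = proj₁ reach
  ≢-1   = proj₂ reach
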